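{- Let $k,M,N_1,\dots,N_k$ be positive integers, $\alpha\in[0,1]$, $\varepsilon>0$, and let $g:\prod_{i=1}^k[N_i]\to[M]^k$ pass the test $\mathcal{T}(\alpha)$ with probability at least $1-\varepsilon$. Then: (1) $g$ passes the test $\mathcal{T}(\alpha^2)$ with probability at least $1-2\varepsilon$; (2) there is an integer $t$ with $\alpha k-\sqrt{k}\le t\le\alpha k+\sqrt{k}$ such that $g$ passes the fixed-intersection test $\mathcal{T}_{\mathrm{fix}}(t)$ with probability at least $1-C\varepsilon$, where $C>0$ is an absolute constant.
   Context: For a positive integer $N$, $[N]=\{0,1,\dots,N\}$. Test $\mathcal{T}(\alpha)$ on $g$: choose $x\in\prod_i[N_i]$ uniformly; independently for each $i$, with probability $\alpha$ set $y_i=x_i$ and put $i$ into the set $A$, and otherwise choose $y_i\in[N_i]$ uniformly; accept iff $g(x)_i=g(y)_i$ for all $i\in A$. Test $\mathcal{T}_{\mathrm{fix}}(t)$ on $g$: choose $x\in\prod_i[N_i]$ uniformly; choose a subset $T\subseteq\{1,\dots,k\}$ of size $t$ uniformly; choose $y\in\prod_i[N_i]$ uniformly conditioned on $y_i=x_i$ for all $i\in T$; accept iff $g(x)_i=g(y)_i$ for all $i\in T$.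
   Formalization: The parameters α and ε are rational numbers. -}

module Defs where

open import Data.Nat as ℕ using (ℕ; zero; suc)
open import Data.Nat.Combinatorics using (_C_)
open import Data.Fin using (Fin; zero; suc)
open import Data.Fin.Properties using (_≟_)
open import Data.Bool using (Bool; true; false; if_then_else_; _∧_; _∨_; not)
open import Data.Integer using (+_)
open import Data.Rational using (ℚ; 0ℚ; 1ℚ; _+_; _*_; _-_; _/_)
open import Data.List using (List; map; foldr)
open import Data.List using () renaming (allFin to allFinL)
open import Relation.Nullary.Decidable using (isYes)

-- 1/n as a rational (total: 1/0 := 0, never used at 0 below)
inv : ℕ → ℚ
inv zero    = 0ℚ
inv (suc n) = (+ 1) / suc n

sumFin : (n : ℕ) → (Fin n → ℚ) → ℚ
sumFin n f = foldr _+_ 0ℚ (map f (allFinL n))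

prodFin : (n : ℕ) → (Fin n → ℚ) → ℚ
prodFin n f = foldr _*_ 1ℚ (map f (allFinL n))

andFin : (n : ℕ) → (Fin n → Bool) → Bool
andFin n f = foldr _∧_ true (map f (allFinL n))

countFin : (n : ℕ) → (Fin n → Bool) → ℕ
countFin n f = foldr ℕ._+_ 0 (map (λ i → if f i then 1 else 0) (allFinL n))

consΠ : {k : ℕ} {n : Fin (suc k) → ℕ} → Fin (n zero) →
        ((i : Fin k) → Fin (n (suc i))) → (i : Fin (suc k)) → Fin (n i)
consΠ a h zero    = a
consΠ a h (suc i) = h i

sumΠ : (k : ℕ) (n : Fin k → ℕ) → (((i : Fin k) → Fin (n i)) → ℚ) → ℚ
sumΠ zero    n f = f (λ ())
sumΠ (suc k) n f =
  sumFin (n zero) (λ a → sumΠ k (λ i → n (suc i)) (λ h → f (consΠ {k} {n} a h)))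

sumSubsets : (k : ℕ) → ((Fin k → Bool) → ℚ) → ℚ
sumSubsets zero    f = f (λ ())
sumSubsets (suc k) f =
  sumSubsets k (λ A → f (cons false A)) + sumSubsets k (λ A → f (cons true A))
  where
  cons : Bool → (Fin k → Bool) → Fin (suc k) → Bool
  cons b A zero    = b
  cons b A (suc i) = A i

-- Domain ∏_{i=1}^k [N i] with [N] = {0,…,N}, range [M]^k
Point : (k : ℕ) → (Fin k → ℕ) → Set
Point k N = (i : Fin k) → Fin (suc (N i))

Map : (k M : ℕ) → (Fin k → ℕ) → Set
Map k M N = Point k N → Fin k → Fin (suc M)

accepts : {k M : ℕ} {N : Fin k → ℕ} → Map k M N → Point k N → Point k N →
          (Fin k → Bool) → Bool
accepts {k} g x y A = andFin k (λ i → not (A i) ∨ isYes (g x i ≟ g y i))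

boolℚ : Bool → ℚ
boolℚ true  = 1ℚ
boolℚ false = 0ℚ

eqℚ : {n : ℕ} → Fin n → Fin n → ℚ
eqℚ a b = boolℚ (isYes (a ≟ b))

-- Pr[g passes T(α)]: x uniform; independently for each i, with prob. α: i ∈ A and y_i = x_i,
-- otherwise i ∉ A and y_i uniform in [N i].
passT : (α : ℚ) {k M : ℕ} {N : Fin k → ℕ} → Map k M N → ℚ
passT α {k} {M} {N} g =
  sumΠ k (λ i → suc (N i)) λ x →
  sumΠ k (λ i → suc (N i)) λ y →
  sumSubsets k λ A →
    prodFin k (λ i → inv (suc (N i)))
    * prodFin k (λ i → if A i then α * eqℚ (x i) (y i)
                              else (1ℚ - α) * inv (suc (N i)))
    * boolℚ (accepts g x y A)

-- Pr[g passes T_fix(t)]: x uniform; T uniform among subsets of size t;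
-- y uniform conditioned on y_i = x_i for i ∈ T.
passTfix : (t : ℕ) {k M : ℕ} {N : Fin k → ℕ} → Map k M N → ℚ
passTfix t {k} {M} {N} g =
  sumΠ k (λ i → suc (N i)) λ x →
  sumΠ k (λ i → suc (N i)) λ y →
  sumSubsets k λ T →
    prodFin k (λ i → inv (suc (N i)))
    * boolℚ (isYes (countFin k T ℕ.≟ t)) * inv (k C t)
    * prodFin k (λ i → if T i then eqℚ (x i) (y i) else inv (suc (N i)))
    * boolℚ (accepts g x y T)

{-# OPTIONS --safe #-}
-- Draw the set A, then a uniform x, then y by the A-correlated step of a Markov kernel K_A on
-- the grid; g fails T(α) with probability E_α[r], where r(A) is the failure probability on A.
-- (1) Two independent α-biased sets intersect in an α²-biased set, and an A-step followed by
--     a B-step is an (A ∩ B)-step (K_A K_B = K_{A∩B}). A failure on (x, z) is a failure on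
--     (x, y) or on (y, z), and the uniform law is K-stationary, so r(A ∩ B) ≤ r(A) + r(B);
--     averaging gives 1 - passT (α²) g ≤ 2ε.
-- (2) The α-biased weight of A depends only on |A|, so T(α) is the mixture of the T_fix(|A|)
--     with |A| binomial. By Chebyshev |A| lies within √k of αk with probability ≥ 3/4, so by
--     Markov not all such t can have T_fix(t)-failure probability above 2ε, as (3/4)·2ε > ε.
module Submission where

open import Defs
open import Data.Nat using (ℕ; suc)
open import Data.Fin using (Fin)
open import Data.Product using (Σ; _×_; ∃)
open import Data.Integer using (+_)
open import Data.Rational using (ℚ; 0ℚ; 1ℚ; _+_; _*_; _-_; _≤_; _<_; _/_)

open import Algebra.Definitions.RawSemiring Data.Rational.+-*-rawSemiring using (_^_)
open import Data.Bool using (Bool; true; false; not; _∧_; _∨_; if_then_else_; T)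
open import Data.Bool.Properties using (T-∧)
open import Data.Empty using (⊥-elim)
open import Data.Fin using (zero; suc)
import Data.Integer as ℤ
import Data.Integer.Properties as ℤₚ
import Data.List as List
open import Data.List using (List; foldr; map; tabulate) renaming (allFin to allFinL)
open import Data.List.Properties using (map-tabulate; map-cong)
open import Data.Nat using (zero)
import Data.Nat as ℕ
import Data.Nat.Properties as ℕₚ
open import Data.Nat.Coprimality as Coprime using ()
open import Data.Nat.Combinatorics using (_C_; nCk+nC[k+1]≡[n+1]C[k+1])
open import Data.Product using (_,_; proj₁; proj₂)
open import Data.Rational using (-_; 1/_; mkℚ; nonNegative; positive)
import Data.Rational.Properties as ℚₚ
open import Data.Sum using (inj₁; inj₂)
open import Data.Unit using (tt)
open import Data.Vec.Functional using (Vector; _∷_; []; zipWith)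
open import Function using (_∘_; id)
open import Function.Bundles using (Equivalence)
open import Level using (0ℓ)
open import Relation.Binary.PropositionalEquality
open import Relation.Nullary using (yes; no; ¬_)
open import Relation.Nullary.Decidable using (isYes; ¬?; _×-dec_; toWitness; fromWitness; dec⇒maybe)
open import Relation.Unary using (Pred; Decidable)
open import Tactic.RingSolver using (solve-∀)
import Tactic.RingSolver.Core.AlmostCommutativeRing as ACR

open ≡-Reasoning

ℚ-ring : ACR.AlmostCommutativeRing 0ℓ 0ℓ
ℚ-ring = ACR.fromCommutativeRing ℚₚ.+-*-commutativeRing (λ x → dec⇒maybe (0ℚ ℚₚ.≟ x))

fromℕ : ℕ → ℚ
fromℕ n = + n / 1

private
  fromℕ′ : ℕ → ℚ
  fromℕ′ n = mkℚ (+ n) 0 (Coprime.sym (Coprime.1-coprimeTo n))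

fromℕ-nonneg : ∀ n → 0ℚ ≤ fromℕ n
fromℕ-nonneg n = ℚₚ.nonNegative⁻¹ (fromℕ n) {{ℚₚ.normalize-nonNeg n 1}}

fromℕ-+ : ∀ m n → fromℕ (m ℕ.+ n) ≡ fromℕ m + fromℕ n
fromℕ-+ m n = begin
  + (m ℕ.+ n) / 1
    ≡⟨ ℚₚ./-cong (sym (cong₂ ℤ._+_ (ℤₚ.*-identityʳ (+ m)) (ℤₚ.*-identityʳ (+ n)))) refl ⟩
  fromℕ′ m + fromℕ′ n
    ≡⟨ cong₂ _+_ (ℚₚ.↥p/↧p≡p (fromℕ′ m)) (ℚₚ.↥p/↧p≡p (fromℕ′ n)) ⟨
  fromℕ m + fromℕ n ∎

fromℕ*inv : ∀ m → fromℕ (suc m) * inv (suc m) ≡ 1ℚ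
fromℕ*inv m = begin
  fromℕ (suc m) * inv (suc m) ≡⟨ cong₂ _*_ (ℚₚ.↥p/↧p≡p c) (ℚₚ.↥p/↧p≡p (1/ c)) ⟩
  c * 1/ c                    ≡⟨ ℚₚ.*-inverseʳ c ⟩
  1ℚ                          ∎
  where c = fromℕ′ (suc m)

fromℕ*inv-positive : ∀ {n} → 1 ℕ.≤ n → fromℕ n * inv n ≡ 1ℚ
fromℕ*inv-positive {suc m} _ = fromℕ*inv m

≤⇒0≤- : ∀ {p q} → p ≤ q → 0ℚ ≤ q - p
≤⇒0≤- {p} {q} p≤q = subst (_≤ q - p) (ℚₚ.+-inverseʳ p) (ℚₚ.+-monoˡ-≤ (- p) p≤q)

0≤-⇒≤ : ∀ {p q} → 0ℚ ≤ q - p → p ≤ q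
0≤-⇒≤ {p} {q} 0≤q-p = subst₂ _≤_ (ℚₚ.+-identityˡ p) ([q-p]+p≡q p q) (ℚₚ.+-monoˡ-≤ p 0≤q-p)
  where
  [q-p]+p≡q : ∀ p q → q - p + p ≡ q
  [q-p]+p≡q = solve-∀ ℚ-ring

sub-antimonoʳ-≤ : ∀ r {p q} → p ≤ q → r - q ≤ r - p
sub-antimonoʳ-≤ r p≤q = ℚₚ.+-monoʳ-≤ r (ℚₚ.neg-antimono-≤ p≤q)

sub-cancelʳ-≤ : ∀ r {p q} → r - q ≤ r - p → p ≤ q
sub-cancelʳ-≤ r {p} {q} r-q≤r-p =
  subst₂ _≤_ (r-[r-x]≡x r p) (r-[r-x]≡x r q) (sub-antimonoʳ-≤ r r-q≤r-p)
  where
  r-[r-x]≡x : ∀ r x → r - (r - x) ≡ x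
  r-[r-x]≡x = solve-∀ ℚ-ring

complement-≤ : ∀ {p ε} → 1ℚ - ε ≤ p → 1ℚ - p ≤ ε
complement-≤ {p} {ε} 1-ε≤p = subst (1ℚ - p ≤_) (1-[1-x]≡x ε) (sub-antimonoʳ-≤ 1ℚ 1-ε≤p)
  where
  1-[1-x]≡x : ∀ x → 1ℚ - (1ℚ - x) ≡ x
  1-[1-x]≡x = solve-∀ ℚ-ring

*-nonneg : ∀ {p q} → 0ℚ ≤ p → 0ℚ ≤ q → 0ℚ ≤ p * q
*-nonneg {p} {q} 0≤p 0≤q = ℚₚ.nonNegative⁻¹ (p * q)
  {{ℚₚ.nonNeg*nonNeg⇒nonNeg p {{nonNegative 0≤p}} q {{nonNegative 0≤q}}}}

*-monoˡ-≤-nonneg : ∀ {r p q} → 0ℚ ≤ r → p ≤ q → r * p ≤ r * q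
*-monoˡ-≤-nonneg {r} 0≤r = ℚₚ.*-monoˡ-≤-nonNeg r {{nonNegative 0≤r}}

0≤1 : 0ℚ ≤ 1ℚ
0≤1 = ℚₚ.<⇒≤ (ℚₚ.positive⁻¹ 1ℚ)

square-nonneg : ∀ p → 0ℚ ≤ p * p
square-nonneg p with ℚₚ.≤-total 0ℚ p
... | inj₁ 0≤p = *-nonneg 0≤p 0≤p
... | inj₂ p≤0 = subst (0ℚ ≤_) ([0-p][0-p]≡pp p) (*-nonneg (≤⇒0≤- p≤0) (≤⇒0≤- p≤0))
  where
  [0-p][0-p]≡pp : ∀ p → (0ℚ - p) * (0ℚ - p) ≡ p * p
  [0-p][0-p]≡pp = solve-∀ ℚ-ring

inv-nonneg : ∀ n → 0ℚ ≤ inv n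
inv-nonneg zero    = ℚₚ.≤-refl
inv-nonneg (suc n) = ℚₚ.nonNegative⁻¹ (inv (suc n)) {{ℚₚ.normalize-nonNeg 1 (suc n)}}

boolℚ-nonneg : ∀ b → 0ℚ ≤ boolℚ b
boolℚ-nonneg true  = 0≤1
boolℚ-nonneg false = ℚₚ.≤-refl

boolℚ+boolℚ-not : ∀ b → boolℚ b + boolℚ (not b) ≡ 1ℚ
boolℚ+boolℚ-not true  = refl
boolℚ+boolℚ-not false = refl

-- Finite sums

record Linear {X : Set} (S : (X → ℚ) → ℚ) : Set where
  field
    ext         : ∀ {f g} → (∀ x → f x ≡ g x) → S f ≡ S g
    additive    : ∀ f g → S (λ x → f x + g x) ≡ S f + S g
    homogeneous : ∀ c f → S (λ x → c * f x) ≡ c * S f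

  zero-valued : S (λ _ → 0ℚ) ≡ 0ℚ
  zero-valued = trans (homogeneous 0ℚ (λ _ → 0ℚ)) (ℚₚ.*-zeroˡ (S (λ _ → 0ℚ)))

  homogeneousʳ : ∀ c f → S (λ x → f x * c) ≡ S f * c
  homogeneousʳ c f = begin
    S (λ x → f x * c) ≡⟨ ext (λ x → ℚₚ.*-comm (f x) c) ⟩
    S (λ x → c * f x) ≡⟨ homogeneous c f ⟩
    c * S f           ≡⟨ ℚₚ.*-comm c (S f) ⟩
    S f * c           ∎

weightedLinear : ∀ {X} {S : (X → ℚ) → ℚ} → Linear S → (w : X → ℚ) →
                 Linear (λ f → S (λ x → w x * f x))
weightedLinear L w = record
  { ext         = λ f≗g → ext (λ x → cong (w x *_) (f≗g x))
  ; additive    = λ f g → trans (ext (λ x → ℚₚ.*-distribˡ-+ (w x) (f x) (g x))) (additive _ _)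
  ; homogeneous = λ c f → trans (ext (λ x → w[cf]≡c[wf] (w x) c (f x))) (homogeneous c _)
  }
  where
  open Linear L
  w[cf]≡c[wf] : ∀ w c f → w * (c * f) ≡ c * (w * f)
  w[cf]≡c[wf] = solve-∀ ℚ-ring

record Summation {X : Set} (S : (X → ℚ) → ℚ) : Set₁ where
  field
    linear      : Linear S
    monotone    : ∀ {f g} → (∀ x → f x ≤ g x) → S f ≤ S g
    interchange : ∀ {Y} {U : (Y → ℚ) → ℚ} → Linear U → (f : X → Y → ℚ) →
                  S (λ x → U (f x)) ≡ U (λ y → S (λ x → f x y))
  open Linear linear public

  nonneg : ∀ {f} → (∀ x → 0ℚ ≤ f x) → 0ℚ ≤ S f
  nonneg 0≤f = subst (_≤ S _) zero-valued (monotone 0≤f)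

module _ {X : Set} where

  zeroSummation : Summation {X} (λ _ → 0ℚ)
  zeroSummation = record
    { linear      = record { ext = λ _ → refl ; additive = λ _ _ → refl
                           ; homogeneous = λ c _ → sym (ℚₚ.*-zeroʳ c) }
    ; monotone    = λ _ → ℚₚ.≤-refl
    ; interchange = λ U _ → sym (Linear.zero-valued U)
    }

  evaluation : (x : X) → Summation (λ f → f x)
  evaluation x = record
    { linear      = record { ext = λ f≗g → f≗g x ; additive = λ _ _ → refl
                           ; homogeneous = λ _ _ → refl }
    ; monotone    = λ f≤g → f≤g x
    ; interchange = λ _ _ → refl
    }

  _⊕_ : ∀ {S T : (X → ℚ) → ℚ} → Summation S → Summation T → Summation (λ f → S f + T f)
  _⊕_ {S} {T} ΣS ΣT = record
    { linear = record
      { ext         = λ f≗g → cong₂ _+_ (S.ext f≗g) (T.ext f≗g)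
      ; additive    = λ f g → trans (cong₂ _+_ (S.additive f g) (T.additive f g))
                                    (interleave (S f) (S g) (T f) (T g))
      ; homogeneous = λ c f → trans (cong₂ _+_ (S.homogeneous c f) (T.homogeneous c f))
                                    (sym (ℚₚ.*-distribˡ-+ c (S f) (T f)))
      }
    ; monotone    = λ f≤g → ℚₚ.+-mono-≤ (S.monotone f≤g) (T.monotone f≤g)
    ; interchange = λ U f → trans (cong₂ _+_ (S.interchange U f) (T.interchange U f))
                                  (sym (Linear.additive U _ _))
    }
    where
    module S = Summation ΣS
    module T = Summation ΣT
    interleave : ∀ a b c d → (a + b) + (c + d) ≡ (a + c) + (b + d)
    interleave = solve-∀ ℚ-ring

  weighted : ∀ {S : (X → ℚ) → ℚ} → Summation S → (w : X → ℚ) → (∀ x → 0ℚ ≤ w x) →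
             Summation (λ f → S (λ x → w x * f x))
  weighted ΣS w 0≤w = record
    { linear      = weightedLinear linear w
    ; monotone    = λ f≤g → monotone (λ x → *-monoˡ-≤-nonneg (0≤w x) (f≤g x))
    ; interchange = λ U f → trans (ext (λ x → sym (Linear.homogeneous U (w x) (f x))))
                                  (interchange U (λ x y → w x * f x y))
    }
    where open Summation ΣS

precompose : ∀ {X Y : Set} {S : (Y → ℚ) → ℚ} (c : Y → X) → Summation S →
             Summation (λ (f : X → ℚ) → S (f ∘ c))
precompose c ΣS = record
  { linear      = record { ext = λ f≗g → ext (f≗g ∘ c) ; additive = λ f g → additive (f ∘ c) (g ∘ c)
                         ; homogeneous = λ a f → homogeneous a (f ∘ c) }
  ; monotone    = λ f≤g → monotone (f≤g ∘ c)
  ; interchange = λ U f → interchange U (f ∘ c)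
  }
  where open Summation ΣS

nested : ∀ {A X : Set} {S : (A → ℚ) → ℚ} {T : A → (X → ℚ) → ℚ} →
         Summation S → (∀ a → Summation (T a)) → Summation (λ f → S (λ a → T a f))
nested {S = S} {T} ΣS ΣT = record
  { linear = record
    { ext         = λ f≗g → ext (λ a → T.ext a f≗g)
    ; additive    = λ f g → trans (ext (λ a → T.additive a f g)) (additive _ _)
    ; homogeneous = λ c f → trans (ext (λ a → T.homogeneous a c f)) (homogeneous c _)
    }
  ; monotone    = λ f≤g → monotone (λ a → T.monotone a f≤g)
  ; interchange = λ U f → trans (ext (λ a → T.interchange a U f))
                                (interchange U (λ a y → T a (λ x → f x y)))
  }
  where
  open Summation ΣS
  module T a = Summation (ΣT a)

listSummation : ∀ {X : Set} (xs : List X) → Summation (λ f → foldr _+_ 0ℚ (map f xs))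
listSummation List.[]       = zeroSummation
listSummation (x List.∷ xs) = evaluation x ⊕ listSummation xs

sumFin-summation : ∀ n → Summation (sumFin n)
sumFin-summation n = listSummation (allFinL n)

sumΠ-summation : ∀ k n → Summation (sumΠ k n)
sumΠ-summation zero    n = evaluation {X = (i : Fin 0) → Fin (n i)} (λ ())
sumΠ-summation (suc k) n =
  nested (sumFin-summation (n zero)) (λ a → precompose (consΠ a) (sumΠ-summation k (n ∘ suc)))

foldr-allFin-suc : ∀ {A : Set} (_∙_ : A → A → A) e n (f : Fin (suc n) → A) →
                   foldr _∙_ e (map f (allFinL (suc n))) ≡
                   f zero ∙ foldr _∙_ e (map (f ∘ suc) (allFinL n))
foldr-allFin-suc _∙_ e n f = begin
  foldr _∙_ e (map f (tabulate id))
    ≡⟨ cong (foldr _∙_ e) (map-tabulate id f) ⟩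
  f zero ∙ foldr _∙_ e (tabulate (f ∘ suc))
    ≡⟨ cong (λ xs → f zero ∙ foldr _∙_ e xs) (map-tabulate id (f ∘ suc)) ⟨
  f zero ∙ foldr _∙_ e (map (f ∘ suc) (allFinL n)) ∎

foldr-allFin-cong : ∀ {A : Set} (_∙_ : A → A → A) e n {f g : Fin n → A} → (∀ i → f i ≡ g i) →
                    foldr _∙_ e (map f (allFinL n)) ≡ foldr _∙_ e (map g (allFinL n))
foldr-allFin-cong _∙_ e n f≗g = cong (foldr _∙_ e) (map-cong f≗g (allFinL n))

sumFin-suc : ∀ n f → sumFin (suc n) f ≡ f zero + sumFin n (f ∘ suc)
sumFin-suc = foldr-allFin-suc _+_ 0ℚ

prodFin-suc : ∀ n f → prodFin (suc n) f ≡ f zero * prodFin n (f ∘ suc)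
prodFin-suc = foldr-allFin-suc _*_ 1ℚ

andFin-suc : ∀ n f → andFin (suc n) f ≡ f zero ∧ andFin n (f ∘ suc)
andFin-suc = foldr-allFin-suc _∧_ true

countFin-suc : ∀ n p → countFin (suc n) p ≡ (if p zero then 1 else 0) ℕ.+ countFin n (p ∘ suc)
countFin-suc n p = foldr-allFin-suc ℕ._+_ 0 n (λ i → if p i then 1 else 0)

prodFin-cong : ∀ n {f g} → (∀ i → f i ≡ g i) → prodFin n f ≡ prodFin n g
prodFin-cong = foldr-allFin-cong _*_ 1ℚ

andFin-cong : ∀ n {p q} → (∀ i → p i ≡ q i) → andFin n p ≡ andFin n q
andFin-cong = foldr-allFin-cong _∧_ true

countFin-cong : ∀ n {p q} → (∀ i → p i ≡ q i) → countFin n p ≡ countFin n q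
countFin-cong n p≗q = foldr-allFin-cong ℕ._+_ 0 n (λ i → cong (λ b → if b then 1 else 0) (p≗q i))

prodFin-* : ∀ n f g → prodFin n (λ i → f i * g i) ≡ prodFin n f * prodFin n g
prodFin-* zero    f g = refl
prodFin-* (suc n) f g = begin
  prodFin (suc n) (λ i → f i * g i)
    ≡⟨ prodFin-suc n (λ i → f i * g i) ⟩
  (f zero * g zero) * prodFin n (λ i → f (suc i) * g (suc i))
    ≡⟨ cong ((f zero * g zero) *_) (prodFin-* n (f ∘ suc) (g ∘ suc)) ⟩
  (f zero * g zero) * (prodFin n (f ∘ suc) * prodFin n (g ∘ suc))
    ≡⟨ interleave (f zero) (g zero) _ _ ⟩
  (f zero * prodFin n (f ∘ suc)) * (g zero * prodFin n (g ∘ suc))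
    ≡⟨ cong₂ _*_ (prodFin-suc n f) (prodFin-suc n g) ⟨
  prodFin (suc n) f * prodFin (suc n) g ∎
  where
  interleave : ∀ a b c d → (a * b) * (c * d) ≡ (a * c) * (b * d)
  interleave = solve-∀ ℚ-ring

prodFin-1 : ∀ n → prodFin n (λ _ → 1ℚ) ≡ 1ℚ
prodFin-1 zero    = refl
prodFin-1 (suc n) = trans (prodFin-suc n (λ _ → 1ℚ)) (cong (1ℚ *_) (prodFin-1 n))

prodFin-nonneg : ∀ n {f} → (∀ i → 0ℚ ≤ f i) → 0ℚ ≤ prodFin n f
prodFin-nonneg zero    0≤f = 0≤1
prodFin-nonneg (suc n) {f} 0≤f =
  subst (0ℚ ≤_) (sym (prodFin-suc n f)) (*-nonneg (0≤f zero) (prodFin-nonneg n (0≤f ∘ suc)))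

sumΠ-prodFin : ∀ k n (f : (i : Fin k) → Fin (n i) → ℚ) →
               sumΠ k n (λ y → prodFin k (λ i → f i (y i))) ≡ prodFin k (λ i → sumFin (n i) (f i))
sumΠ-prodFin zero    n f = refl
sumΠ-prodFin (suc k) n f = begin
  sumFin (n zero) (λ a → sumΠ k (n ∘ suc) (λ y → prodFin (suc k) (λ i → f i (consΠ {k} {n} a y i))))
    ≡⟨ Σ₀.ext (λ a → Σ₁.ext (λ y → prodFin-suc k (λ i → f i (consΠ {k} {n} a y i)))) ⟩
  sumFin (n zero) (λ a → sumΠ k (n ∘ suc) (λ y → f zero a * prodFin k (λ i → f (suc i) (y i))))
    ≡⟨ Σ₀.ext (λ a → Σ₁.homogeneous (f zero a) _) ⟩
  sumFin (n zero) (λ a → f zero a * sumΠ k (n ∘ suc) (λ y → prodFin k (λ i → f (suc i) (y i))))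
    ≡⟨ Σ₀.homogeneousʳ _ (f zero) ⟩
  sumFin (n zero) (f zero) * sumΠ k (n ∘ suc) (λ y → prodFin k (λ i → f (suc i) (y i)))
    ≡⟨ cong (sumFin (n zero) (f zero) *_) (sumΠ-prodFin k (n ∘ suc) (f ∘ suc)) ⟩
  sumFin (n zero) (f zero) * prodFin k (λ i → sumFin (n (suc i)) (f (suc i)))
    ≡⟨ prodFin-suc k (λ i → sumFin (n i) (f i)) ⟨
  prodFin (suc k) (λ i → sumFin (n i) (f i)) ∎
  where
  module Σ₀ = Summation (sumFin-summation (n zero))
  module Σ₁ = Summation (sumΠ-summation k (n ∘ suc))

sumFin-const : ∀ n c → sumFin n (λ _ → c) ≡ fromℕ n * c
sumFin-const zero    c = sym (ℚₚ.*-zeroˡ c)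
sumFin-const (suc n) c = begin
  sumFin (suc n) (λ _ → c)  ≡⟨ sumFin-suc n (λ _ → c) ⟩
  c + sumFin n (λ _ → c)    ≡⟨ cong (_+_ c) (sumFin-const n c) ⟩
  c + fromℕ n * c           ≡⟨ c+nc≡[1+n]c c (fromℕ n) ⟩
  (1ℚ + fromℕ n) * c        ≡⟨ cong (_* c) (fromℕ-+ 1 n) ⟨
  fromℕ (suc n) * c         ∎
  where
  c+nc≡[1+n]c : ∀ c n → c + n * c ≡ (1ℚ + n) * c
  c+nc≡[1+n]c = solve-∀ ℚ-ring

sumFin-inv : ∀ m → sumFin (suc m) (λ _ → inv (suc m)) ≡ 1ℚ
sumFin-inv m = trans (sumFin-const (suc m) _) (fromℕ*inv m)

eqℚ-suc : ∀ {n} (x y : Fin n) → eqℚ (suc x) (suc y) ≡ eqℚ x y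
eqℚ-suc x y with x Data.Fin.≟ y
... | yes _ = refl
... | no  _ = refl

eqℚ-sym : ∀ {n} (x y : Fin n) → eqℚ x y ≡ eqℚ y x
eqℚ-sym zero    zero    = refl
eqℚ-sym zero    (suc y) = refl
eqℚ-sym (suc x) zero    = refl
eqℚ-sym (suc x) (suc y) = trans (eqℚ-suc x y) (trans (eqℚ-sym x y) (sym (eqℚ-suc y x)))

sumFin-eqℚ : ∀ n (x : Fin n) f → sumFin n (λ y → eqℚ x y * f y) ≡ f x
sumFin-eqℚ (suc n) zero    f = begin
  sumFin (suc n) (λ y → eqℚ zero y * f y)  ≡⟨ sumFin-suc n (λ y → eqℚ zero y * f y) ⟩
  1ℚ * f zero + sumFin n (λ y → 0ℚ * f (suc y))
    ≡⟨ cong₂ _+_ (ℚₚ.*-identityˡ (f zero)) (trans (ext (λ y → ℚₚ.*-zeroˡ (f (suc y)))) zero-valued) ⟩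
  f zero + 0ℚ                              ≡⟨ ℚₚ.+-identityʳ (f zero) ⟩
  f zero                                   ∎
  where open Summation (sumFin-summation n)
sumFin-eqℚ (suc n) (suc x) f = begin
  sumFin (suc n) (λ y → eqℚ (suc x) y * f y)  ≡⟨ sumFin-suc n (λ y → eqℚ (suc x) y * f y) ⟩
  0ℚ * f zero + sumFin n (λ y → eqℚ (suc x) (suc y) * f (suc y))
    ≡⟨ cong₂ _+_ (ℚₚ.*-zeroˡ (f zero)) (ext (λ y → cong (_* f (suc y)) (eqℚ-suc x y))) ⟩
  0ℚ + sumFin n (λ y → eqℚ x y * f (suc y))   ≡⟨ ℚₚ.+-identityˡ _ ⟩
  sumFin n (λ y → eqℚ x y * f (suc y))        ≡⟨ sumFin-eqℚ n x (λ y → f (suc y)) ⟩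
  f (suc x)                                   ∎
  where open Summation (sumFin-summation n)

-- Random subsets of {1, …, k}

Subset : ℕ → Set
Subset = Vector Bool

_∩_ : ∀ {k} → Subset k → Subset k → Subset k
_∩_ = zipWith _∧_

Extensional : ∀ {k} → (Subset k → ℚ) → Set
Extensional f = ∀ {A B} → (∀ i → A i ≡ B i) → f A ≡ f B

-- Unlike Defs.sumSubsets, which extends A with a cons function local to each call and
-- depending on the summand, this sum is extensional in the summand.
sumSub : (k : ℕ) → (Subset k → ℚ) → ℚ
sumSub zero    f = f []
sumSub (suc k) f = sumSub k (λ A → f (false ∷ A)) + sumSub k (λ A → f (true ∷ A))

sumSub-summation : ∀ k → Summation (sumSub k)
sumSub-summation zero    = evaluation []
sumSub-summation (suc k) =
  precompose (false ∷_) (sumSub-summation k) ⊕ precompose (true ∷_) (sumSub-summation k)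

sumSubsets≡sumSub : ∀ k {f} → Extensional f → sumSubsets k f ≡ sumSub k f
sumSubsets≡sumSub zero    f-ext = f-ext (λ ())
sumSubsets≡sumSub (suc k) f-ext = cong₂ _+_
  (trans (sumSubsets≡sumSub k (λ A≗B → f-ext (λ { zero → refl ; (suc i) → A≗B i })))
         (ext (λ A → f-ext (λ { zero → refl ; (suc i) → refl }))))
  (trans (sumSubsets≡sumSub k (λ A≗B → f-ext (λ { zero → refl ; (suc i) → A≗B i })))
         (ext (λ A → f-ext (λ { zero → refl ; (suc i) → refl }))))
  where open Summation (sumSub-summation k)

∣_∣ : ∀ {k} → Subset k → ℕ
∣_∣ {k} A = countFin k A

∣∣-∷ : ∀ {k} b (A : Subset k) → ∣ b ∷ A ∣ ≡ (if b then 1 else 0) ℕ.+ ∣ A ∣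
∣∣-∷ {k} b A = countFin-suc k (b ∷ A)

∣∣≤ : ∀ {k} (A : Subset k) → ∣ A ∣ ℕ.≤ k
∣∣≤ {zero}  A = ℕ.z≤n
∣∣≤ {suc k} A = subst (ℕ._≤ suc k) (sym (countFin-suc k A)) (bound (A zero))
  where
  bound : ∀ b → (if b then 1 else 0) ℕ.+ ∣ A ∘ suc ∣ ℕ.≤ suc k
  bound true  = ℕ.s≤s (∣∣≤ (A ∘ suc))
  bound false = ℕₚ.m≤n⇒m≤1+n (∣∣≤ (A ∘ suc))

∷-∩-∷ : ∀ {k} a b (A B : Subset k) i → ((a ∷ A) ∩ (b ∷ B)) i ≡ ((a ∧ b) ∷ (A ∩ B)) i
∷-∩-∷ a b A B zero    = refl
∷-∩-∷ a b A B (suc i) = refl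

bernoulli : ℚ → Bool → ℚ
bernoulli α b = if b then α else 1ℚ - α

bernoulli-nonneg : ∀ {α} → 0ℚ ≤ α → α ≤ 1ℚ → ∀ b → 0ℚ ≤ bernoulli α b
bernoulli-nonneg 0≤α α≤1 true  = 0≤α
bernoulli-nonneg 0≤α α≤1 false = ≤⇒0≤- α≤1

bernoulli-split : ∀ α b (e v : ℚ) →
                  (if b then α * e else (1ℚ - α) * v) ≡ bernoulli α b * (if b then e else v)
bernoulli-split α true  e v = refl
bernoulli-split α false e v = refl

biased : ∀ {k} → ℚ → Subset k → ℚ
biased {k} α A = prodFin k (λ i → bernoulli α (A i))

biased-nonneg : ∀ {k α} → 0ℚ ≤ α → α ≤ 1ℚ → (A : Subset k) → 0ℚ ≤ biased α A
biased-nonneg {k} 0≤α α≤1 A = prodFin-nonneg k (λ i → bernoulli-nonneg 0≤α α≤1 (A i))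

biased-∷ : ∀ {k} α b (A : Subset k) → biased α (b ∷ A) ≡ bernoulli α b * biased α A
biased-∷ {k} α b A = prodFin-suc k (λ i → bernoulli α ((b ∷ A) i))

sizeWeight : ℕ → ℚ → ℕ → ℚ
sizeWeight k α t = α ^ t * (1ℚ - α) ^ (k ℕ.∸ t)

biased≡sizeWeight : ∀ {k} α (A : Subset k) → biased α A ≡ sizeWeight k α ∣ A ∣
biased≡sizeWeight {zero}  α A = refl
biased≡sizeWeight {suc k} α A = begin
  biased α A                                 ≡⟨ prodFin-suc k (λ i → bernoulli α (A i)) ⟩
  bernoulli α (A zero) * biased α (A ∘ suc)  ≡⟨ cong (bernoulli α (A zero) *_) (biased≡sizeWeight α (A ∘ suc)) ⟩
  bernoulli α (A zero) * sizeWeight k α c    ≡⟨ extend (A zero) ⟩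
  sizeWeight (suc k) α ((if A zero then 1 else 0) ℕ.+ c)
                                             ≡⟨ cong (sizeWeight (suc k) α) (countFin-suc k A) ⟨
  sizeWeight (suc k) α ∣ A ∣                 ∎
  where
  c : ℕ
  c = ∣ A ∘ suc ∣
  b[xy]≡x[by] : ∀ b x y → b * (x * y) ≡ x * (b * y)
  b[xy]≡x[by] = solve-∀ ℚ-ring
  extend : ∀ b → bernoulli α b * sizeWeight k α c ≡ sizeWeight (suc k) α ((if b then 1 else 0) ℕ.+ c)
  extend true  = sym (ℚₚ.*-assoc α (α ^ c) _)
  extend false = trans (b[xy]≡x[by] (1ℚ - α) (α ^ c) _)
                       (cong (λ n → α ^ c * (1ℚ - α) ^ n) (sym (ℕₚ.+-∸-assoc 1 (∣∣≤ (A ∘ suc)))))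

expect : ∀ {k} → ℚ → (Subset k → ℚ) → ℚ
expect {k} α ψ = sumSub k (λ A → biased α A * ψ A)

expect-linear : ∀ k α → Linear (expect {k} α)
expect-linear k α = weightedLinear (Summation.linear (sumSub-summation k)) (biased α)

expect-summation : ∀ k {α} → 0ℚ ≤ α → α ≤ 1ℚ → Summation (expect {k} α)
expect-summation k 0≤α α≤1 = weighted (sumSub-summation k) (biased _) (biased-nonneg 0≤α α≤1)

expect-∷ : ∀ {k} α (ψ : Subset (suc k) → ℚ) →
           expect α ψ ≡ (1ℚ - α) * expect α (ψ ∘ (false ∷_)) + α * expect α (ψ ∘ (true ∷_))
expect-∷ {k} α ψ = cong₂ _+_ (branch false) (branch true)
  where
  open Summation (sumSub-summation k)
  branch : ∀ b → sumSub k (λ A → biased α (b ∷ A) * ψ (b ∷ A)) ≡ bernoulli α b * expect α (ψ ∘ (b ∷_))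
  branch b = begin
    sumSub k (λ A → biased α (b ∷ A) * ψ (b ∷ A))
      ≡⟨ ext (λ A → trans (cong (_* ψ (b ∷ A)) (biased-∷ α b A))
                          (ℚₚ.*-assoc (bernoulli α b) (biased α A) (ψ (b ∷ A)))) ⟩
    sumSub k (λ A → bernoulli α b * (biased α A * ψ (b ∷ A)))
      ≡⟨ homogeneous (bernoulli α b) _ ⟩
    bernoulli α b * expect α (ψ ∘ (b ∷_)) ∎

expect-const : ∀ k α c → expect {k} α (λ _ → c) ≡ c
expect-const zero    α c = ℚₚ.*-identityˡ c
expect-const (suc k) α c = begin
  expect {suc k} α (λ _ → c)
    ≡⟨ expect-∷ {k} α (λ _ → c) ⟩
  (1ℚ - α) * expect {k} α (λ _ → c) + α * expect {k} α (λ _ → c)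
    ≡⟨ cong₂ (λ u v → (1ℚ - α) * u + α * v) (expect-const k α c) (expect-const k α c) ⟩
  (1ℚ - α) * c + α * c
    ≡⟨ [1-α]c+αc≡c α c ⟩
  c ∎
  where
  [1-α]c+αc≡c : ∀ α c → (1ℚ - α) * c + α * c ≡ c
  [1-α]c+αc≡c = solve-∀ ℚ-ring

expect-complement : ∀ k α f → expect {k} α (λ A → 1ℚ - f A) ≡ 1ℚ - expect α f
expect-complement k α f = begin
  expect α (λ A → 1ℚ - f A)                    ≡⟨ ext (λ A → 1-x≡1+[-1]x (f A)) ⟩
  expect α (λ A → 1ℚ + (- 1ℚ) * f A)           ≡⟨ additive (λ _ → 1ℚ) (λ A → (- 1ℚ) * f A) ⟩
  expect {k} α (λ _ → 1ℚ) + expect α (λ A → (- 1ℚ) * f A)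
                                               ≡⟨ cong₂ _+_ (expect-const k α 1ℚ) (homogeneous (- 1ℚ) f) ⟩
  1ℚ + (- 1ℚ) * expect α f                     ≡⟨ 1-x≡1+[-1]x (expect α f) ⟨
  1ℚ - expect α f                              ∎
  where
  open Linear (expect-linear k α)
  1-x≡1+[-1]x : ∀ x → 1ℚ - x ≡ 1ℚ + (- 1ℚ) * x
  1-x≡1+[-1]x = solve-∀ ℚ-ring

expect-∩ : ∀ {k} α (φ : Subset k → ℚ) → Extensional φ →
           expect (α * α) φ ≡ expect α (λ A → expect α (λ B → φ (A ∩ B)))
expect-∩ {zero}  α φ φ-ext =
  cong (1ℚ *_) (trans (sym (ℚₚ.*-identityˡ (φ []))) (cong (1ℚ *_) (φ-ext (λ ()))))
expect-∩ {suc k} α φ φ-ext = begin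
  expect (α * α) φ
    ≡⟨ expect-∷ (α * α) φ ⟩
  (1ℚ - α * α) * expect (α * α) (φ ∘ (false ∷_)) + α * α * expect (α * α) (φ ∘ (true ∷_))
    ≡⟨ cong₂ (λ u v → (1ℚ - α * α) * u + α * α * v)
             (expect-∩ α (φ ∘ (false ∷_)) (restrict false)) (expect-∩ α (φ ∘ (true ∷_)) (restrict true)) ⟩
  (1ℚ - α * α) * Y false + α * α * Y true
    ≡⟨ regroup α (Y false) (Y true) ⟩
  (1ℚ - α) * ((1ℚ - α) * Y false + α * Y false) + α * ((1ℚ - α) * Y false + α * Y true)
    ≡⟨ cong₂ (λ u v → (1ℚ - α) * u + α * v) (split false) (split true) ⟨
  (1ℚ - α) * expect α (λ A → expect α (λ B → φ ((false ∷ A) ∩ B)))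
    + α * expect α (λ A → expect α (λ B → φ ((true ∷ A) ∩ B)))
    ≡⟨ expect-∷ α (λ A → expect α (λ B → φ (A ∩ B))) ⟨
  expect α (λ A → expect α (λ B → φ (A ∩ B))) ∎
  where
  open Linear (expect-linear k α)
  restrict : ∀ b → Extensional (φ ∘ (b ∷_))
  restrict b A≗B = φ-ext (λ { zero → refl ; (suc i) → A≗B i })
  Y : Bool → ℚ
  Y b = expect α (λ A → expect α (λ B → φ (b ∷ (A ∩ B))))
  regroup : ∀ α y₀ y₁ → (1ℚ - α * α) * y₀ + α * α * y₁ ≡
                        (1ℚ - α) * ((1ℚ - α) * y₀ + α * y₀) + α * ((1ℚ - α) * y₀ + α * y₁)
  regroup = solve-∀ ℚ-ring
  split : ∀ a → expect α (λ A → expect α (λ B → φ ((a ∷ A) ∩ B))) ≡ (1ℚ - α) * Y (a ∧ false) + α * Y (a ∧ true)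
  split a = begin
    expect α (λ A → expect α (λ B → φ ((a ∷ A) ∩ B)))
      ≡⟨ ext (λ A → expect-∷ α (λ B → φ ((a ∷ A) ∩ B))) ⟩
    expect α (λ A → (1ℚ - α) * expect α (λ B → φ ((a ∷ A) ∩ (false ∷ B)))
                    + α * expect α (λ B → φ ((a ∷ A) ∩ (true ∷ B))))
      ≡⟨ ext (λ A → cong₂ (λ u v → (1ℚ - α) * u + α * v) (ext (λ B → φ-ext (∷-∩-∷ a false A B)))
                                                          (ext (λ B → φ-ext (∷-∩-∷ a true A B)))) ⟩
    expect α (λ A → (1ℚ - α) * expect α (λ B → φ ((a ∧ false) ∷ (A ∩ B)))
                    + α * expect α (λ B → φ ((a ∧ true) ∷ (A ∩ B))))
      ≡⟨ additive _ _ ⟩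
    expect α (λ A → (1ℚ - α) * expect α (λ B → φ ((a ∧ false) ∷ (A ∩ B))))
      + expect α (λ A → α * expect α (λ B → φ ((a ∧ true) ∷ (A ∩ B))))
      ≡⟨ cong₂ _+_ (homogeneous (1ℚ - α) _) (homogeneous α _) ⟩
    (1ℚ - α) * Y (a ∧ false) + α * Y (a ∧ true) ∎

indicator : ∀ {X : Set} {P : Pred X 0ℓ} → Decidable P → X → ℚ
indicator P? x = boolℚ (isYes (P? x))

indicator+indicator-¬ : ∀ {X : Set} {P : Pred X 0ℓ} (P? : Decidable P) x →
                        indicator P? x + indicator (¬? ∘ P?) x ≡ 1ℚ
indicator+indicator-¬ P? x with P? x
... | yes _ = refl
... | no  _ = refl

markov : ∀ {X : Set} {S : (X → ℚ) → ℚ} {P : Pred X 0ℓ} → Summation S → (P? : Decidable P) →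
         ∀ {f c} → (∀ x → 0ℚ ≤ f x) → (∀ x → P x → c ≤ f x) → c * S (indicator P?) ≤ S f
markov {S = S} ΣS P? {f} {c} 0≤f c≤f = subst (_≤ S f) (homogeneous c (indicator P?)) (monotone below)
  where
  open Summation ΣS
  below : ∀ x → c * indicator P? x ≤ f x
  below x with P? x
  ... | yes Px = subst (_≤ f x) (sym (ℚₚ.*-identityʳ c)) (c≤f x Px)
  ... | no  _  = subst (_≤ f x) (sym (ℚₚ.*-zeroʳ c)) (0≤f x)

deviation : ∀ {k} → ℚ → Subset k → ℚ
deviation {k} α A = fromℕ ∣ A ∣ - α * fromℕ k

expect-deviation² : ∀ k α → expect α (λ A → deviation {k} α A * deviation α A) ≡ fromℕ k * (α * (1ℚ - α))
expect-deviation² zero    α = base α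
  where
  base : ∀ α → 1ℚ * ((0ℚ - α * 0ℚ) * (0ℚ - α * 0ℚ)) ≡ 0ℚ * (α * (1ℚ - α))
  base = solve-∀ ℚ-ring
expect-deviation² (suc k) α = begin
  expect {suc k} α (λ A → deviation α A * deviation α A)
    ≡⟨ expect-∷ {k} α (λ A → deviation α A * deviation α A) ⟩
  (1ℚ - α) * E (λ A → deviation α (false ∷ A) * deviation α (false ∷ A))
    + α * E (λ A → deviation α (true ∷ A) * deviation α (true ∷ A))
    ≡⟨ cong₂ (λ u w → (1ℚ - α) * u + α * w) (ext (λ A → cong (λ d → d * d) (deviation-false A)))
                                            (ext (λ A → cong (λ d → d * d) (deviation-true A))) ⟩
  (1ℚ - α) * E (λ A → d₀ A * d₀ A) + α * E (λ A → d₁ A * d₁ A)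
    ≡⟨ trans (additive _ _) (cong₂ _+_ (homogeneous (1ℚ - α) _) (homogeneous α _)) ⟨
  E (λ A → (1ℚ - α) * (d₀ A * d₀ A) + α * (d₁ A * d₁ A))
    ≡⟨ ext (λ A → mix α (x A) K) ⟩
  E (λ A → deviation α A * deviation α A + v)
    ≡⟨ additive _ _ ⟩
  E (λ A → deviation α A * deviation α A) + E (λ _ → v)
    ≡⟨ cong₂ _+_ (expect-deviation² k α) (expect-const k α v) ⟩
  K * v + v
    ≡⟨ Kv+v≡[1+K]v K v ⟩
  (1ℚ + K) * v
    ≡⟨ cong (_* v) (fromℕ-+ 1 k) ⟨
  fromℕ (suc k) * v ∎
  where
  open Linear (expect-linear k α)
  E : (Subset k → ℚ) → ℚ
  E = expect α
  K v : ℚ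
  K = fromℕ k
  v = α * (1ℚ - α)
  x d₀ d₁ : Subset k → ℚ
  x A = fromℕ ∣ A ∣
  d₀ A = x A - α * (1ℚ + K)
  d₁ A = 1ℚ + x A - α * (1ℚ + K)
  deviation-false : ∀ A → deviation α (false ∷ A) ≡ d₀ A
  deviation-false A = cong₂ (λ n m → fromℕ n - α * m) (∣∣-∷ false A) (fromℕ-+ 1 k)
  deviation-true : ∀ A → deviation α (true ∷ A) ≡ d₁ A
  deviation-true A = cong₂ (λ n m → n - α * m) (trans (cong fromℕ (∣∣-∷ true A)) (fromℕ-+ 1 ∣ A ∣))
                                                (fromℕ-+ 1 k)
  mix : ∀ α x K → (1ℚ - α) * ((x - α * (1ℚ + K)) * (x - α * (1ℚ + K)))
                  + α * ((1ℚ + x - α * (1ℚ + K)) * (1ℚ + x - α * (1ℚ + K)))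
                ≡ (x - α * K) * (x - α * K) + α * (1ℚ - α)
  mix = solve-∀ ℚ-ring
  Kv+v≡[1+K]v : ∀ K v → K * v + v ≡ (1ℚ + K) * v
  Kv+v≡[1+K]v = solve-∀ ℚ-ring

bernoulli-variance≤¼ : ∀ α → α * (1ℚ - α) ≤ + 1 / 4
bernoulli-variance≤¼ α = 0≤-⇒≤ (subst (0ℚ ≤_) (sym (completeSquare α)) (square-nonneg (α - + 1 / 2)))
  where
  completeSquare : ∀ α → + 1 / 4 - α * (1ℚ - α) ≡ (α - + 1 / 2) * (α - + 1 / 2)
  completeSquare = solve-∀ ℚ-ring

-- αk - √k ≤ t ≤ αk + √k, squared.
Near : ℕ → ℚ → ℕ → Set
Near k α t = (fromℕ t - α * fromℕ k) * (fromℕ t - α * fromℕ k) ≤ fromℕ k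

near? : ∀ k α → Decidable (Near k α)
near? k α t = _ ℚₚ.≤? _

-- |A| has mean αk and variance kα(1 - α) ≤ k/4.
chebyshev : ∀ k {α} → 1 ℕ.≤ k → 0ℚ ≤ α → α ≤ 1ℚ →
            + 3 / 4 ≤ expect {k} α (λ A → indicator (near? k α) ∣ A ∣)
chebyshev (suc k′) {α} 1≤k 0≤α α≤1 = subst (+ 3 / 4 ≤_) typical≡1-atypical (sub-antimonoʳ-≤ 1ℚ atypical≤¼)
  where
  k : ℕ
  k = suc k′
  open Summation (expect-summation k 0≤α α≤1)
  E : (Subset k → ℚ) → ℚ
  E = expect α
  typical? : Decidable (λ (A : Subset k) → Near k α ∣ A ∣)
  typical? = near? k α ∘ ∣_∣
  atypical? : Decidable (λ (A : Subset k) → ¬ Near k α ∣ A ∣)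
  atypical? = ¬? ∘ typical?
  k*atypical≤k*¼ : fromℕ k * E (indicator atypical?) ≤ fromℕ k * (+ 1 / 4)
  k*atypical≤k*¼ = ℚₚ.≤-trans
    (markov (expect-summation k 0≤α α≤1) atypical? (λ A → square-nonneg (deviation α A))
            (λ A atypical → ℚₚ.<⇒≤ (ℚₚ.≰⇒> atypical)))
    (subst (_≤ fromℕ k * (+ 1 / 4)) (sym (expect-deviation² k α))
           (*-monoˡ-≤-nonneg (fromℕ-nonneg k) (bernoulli-variance≤¼ α)))
  atypical≤¼ : E (indicator atypical?) ≤ + 1 / 4
  atypical≤¼ = ℚₚ.*-cancelˡ-≤-pos (fromℕ k) {{ℚₚ.normalize-pos k 1}} k*atypical≤k*¼
  [a+b]-b≡a : ∀ a b → a + b - b ≡ a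
  [a+b]-b≡a = solve-∀ ℚ-ring
  typical≡1-atypical : 1ℚ - E (indicator atypical?) ≡ E (indicator typical?)
  typical≡1-atypical = begin
    1ℚ - E (indicator atypical?)
      ≡⟨ cong (_- E (indicator atypical?))
              (trans (ext (indicator+indicator-¬ typical?)) (expect-const k α 1ℚ)) ⟨
    E (λ A → indicator typical? A + indicator atypical? A) - E (indicator atypical?)
      ≡⟨ cong (_- E (indicator atypical?)) (additive (indicator typical?) (indicator atypical?)) ⟩
    E (indicator typical?) + E (indicator atypical?) - E (indicator atypical?)
      ≡⟨ [a+b]-b≡a _ _ ⟩
    E (indicator typical?) ∎

δ : ℕ → ℕ → ℚ
δ m n = boolℚ (isYes (m ℕ.≟ n))

δ-nonneg : ∀ m n → 0ℚ ≤ δ m n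
δ-nonneg m n = boolℚ-nonneg (isYes (m ℕ.≟ n))

δ-≡ : ∀ {m n} → m ≡ n → δ m n ≡ 1ℚ
δ-≡ {m} {n} m≡n with m ℕ.≟ n
... | yes _   = refl
... | no m≢n = ⊥-elim (m≢n m≡n)

δ-≢ : ∀ {m n} → m ≢ n → δ m n ≡ 0ℚ
δ-≢ {m} {n} m≢n with m ℕ.≟ n
... | yes m≡n = ⊥-elim (m≢n m≡n)
... | no  _   = refl

δ-sym : ∀ m n → δ m n ≡ δ n m
δ-sym m n with m ℕ.≟ n
... | yes m≡n = sym (δ-≡ (sym m≡n))
... | no  m≢n = sym (δ-≢ (m≢n ∘ sym))

δ-suc : ∀ m n → δ (suc m) (suc n) ≡ δ m n
δ-suc m n with m ℕ.≟ n
... | yes m≡n = δ-≡ (cong suc m≡n)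
... | no  m≢n = δ-≢ (m≢n ∘ ℕₚ.suc-injective)

δ*-transport : ∀ m n (F : ℕ → ℚ) → δ m n * F m ≡ δ m n * F n
δ*-transport m n F with m ℕ.≟ n
... | yes refl = refl
... | no  _    = trans (ℚₚ.*-zeroˡ (F m)) (sym (ℚₚ.*-zeroˡ (F n)))

layerSize : ∀ k t → sumSub k (λ A → δ ∣ A ∣ t) ≡ fromℕ (k C t)
layerSize zero    zero    = refl
layerSize zero    (suc t) = refl
layerSize (suc k) t = begin
  sumSub k (λ A → δ ∣ false ∷ A ∣ t) + sumSub k (λ A → δ ∣ true ∷ A ∣ t)
    ≡⟨ cong₂ _+_ (ext (λ A → cong (λ n → δ n t) (∣∣-∷ false A)))
                 (ext (λ A → cong (λ n → δ n t) (∣∣-∷ true A))) ⟩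
  sumSub k (λ A → δ ∣ A ∣ t) + sumSub k (λ A → δ (suc ∣ A ∣) t)
    ≡⟨ pascal t ⟩
  fromℕ (suc k C t) ∎
  where
  open Summation (sumSub-summation k)
  pascal : ∀ t → sumSub k (λ A → δ ∣ A ∣ t) + sumSub k (λ A → δ (suc ∣ A ∣) t) ≡ fromℕ (suc k C t)
  pascal zero    = cong₂ _+_ (layerSize k 0) zero-valued
  pascal (suc t) = begin
    sumSub k (λ A → δ ∣ A ∣ (suc t)) + sumSub k (λ A → δ (suc ∣ A ∣) (suc t))
      ≡⟨ cong₂ _+_ (layerSize k (suc t)) (trans (ext (λ A → δ-suc ∣ A ∣ t)) (layerSize k t)) ⟩
    fromℕ (k C suc t) + fromℕ (k C t)
      ≡⟨ ℚₚ.+-comm (fromℕ (k C suc t)) (fromℕ (k C t)) ⟩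
    fromℕ (k C t) + fromℕ (k C suc t)
      ≡⟨ fromℕ-+ (k C t) (k C suc t) ⟨
    fromℕ (k C t ℕ.+ k C suc t)
      ≡⟨ cong fromℕ (nCk+nC[k+1]≡[n+1]C[k+1] k t) ⟩
    fromℕ (suc k C suc t) ∎

C-positive : ∀ {k t} → t ℕ.≤ k → 1 ℕ.≤ k C t
C-positive {k}     {zero}  _             = ℕ.s≤s ℕ.z≤n
C-positive {suc k} {suc t} (ℕ.s≤s t≤k) =
  subst (1 ℕ.≤_) (nCk+nC[k+1]≡[n+1]C[k+1] k t) (ℕₚ.≤-trans (C-positive t≤k) (ℕₚ.m≤m+n _ _))

layerAverage : ∀ k → ℕ → (Subset k → ℚ) → ℚ
layerAverage k t ψ = inv (k C t) * sumSub k (λ T → δ ∣ T ∣ t * ψ T)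

sumSub-layerAverage : ∀ k (w : ℕ → ℚ) ψ →
  sumSub k (λ A → w ∣ A ∣ * layerAverage k ∣ A ∣ ψ) ≡ sumSub k (λ A → w ∣ A ∣ * ψ A)
sumSub-layerAverage k w ψ = begin
  sumSub k (λ A → w ∣ A ∣ * (inv (k C ∣ A ∣) * sumSub k (λ T → δ ∣ T ∣ ∣ A ∣ * ψ T)))
    ≡⟨ ext (λ A → trans (sym (ℚₚ.*-assoc (w ∣ A ∣) _ _)) (sym (homogeneous (c ∣ A ∣) _))) ⟩
  sumSub k (λ A → sumSub k (λ T → c ∣ A ∣ * (δ ∣ T ∣ ∣ A ∣ * ψ T)))
    ≡⟨ interchange linear (λ A T → c ∣ A ∣ * (δ ∣ T ∣ ∣ A ∣ * ψ T)) ⟩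
  sumSub k (λ T → sumSub k (λ A → c ∣ A ∣ * (δ ∣ T ∣ ∣ A ∣ * ψ T)))
    ≡⟨ ext (λ T → ext (λ A → transport ∣ T ∣ ∣ A ∣ (ψ T))) ⟩
  sumSub k (λ T → sumSub k (λ A → δ ∣ A ∣ ∣ T ∣ * (c ∣ T ∣ * ψ T)))
    ≡⟨ ext (λ T → trans (homogeneousʳ _ (λ A → δ ∣ A ∣ ∣ T ∣))
                        (cong (_* (c ∣ T ∣ * ψ T)) (layerSize k ∣ T ∣))) ⟩
  sumSub k (λ T → fromℕ (k C ∣ T ∣) * (c ∣ T ∣ * ψ T))
    ≡⟨ ext (λ T → cancel (C-positive (∣∣≤ T)) (w ∣ T ∣) (ψ T)) ⟩
  sumSub k (λ T → w ∣ T ∣ * ψ T) ∎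
  where
  open Summation (sumSub-summation k)
  c : ℕ → ℚ
  c n = w n * inv (k C n)
  x[yz]≡y[xz] : ∀ x y z → x * (y * z) ≡ y * (x * z)
  x[yz]≡y[xz] = solve-∀ ℚ-ring
  transport : ∀ t a y → c a * (δ t a * y) ≡ δ a t * (c t * y)
  transport t a y = begin
    c a * (δ t a * y)  ≡⟨ x[yz]≡y[xz] (c a) (δ t a) y ⟩
    δ t a * (c a * y)  ≡⟨ δ*-transport t a (λ n → c n * y) ⟨
    δ t a * (c t * y)  ≡⟨ cong (_* (c t * y)) (δ-sym t a) ⟩
    δ a t * (c t * y)  ∎
  cancel : ∀ {n} → 1 ℕ.≤ n → ∀ v y → fromℕ n * ((v * inv n) * y) ≡ v * y
  cancel {n} 1≤n v y = begin
    fromℕ n * ((v * inv n) * y)  ≡⟨ regroup (fromℕ n) (inv n) v y ⟩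
    (fromℕ n * inv n) * (v * y)  ≡⟨ cong (_* (v * y)) (fromℕ*inv-positive 1≤n) ⟩
    1ℚ * (v * y)                 ≡⟨ ℚₚ.*-identityˡ (v * y) ⟩
    v * y                        ∎
    where
    regroup : ∀ n i v y → n * ((v * i) * y) ≡ (n * i) * (v * y)
    regroup = solve-∀ ℚ-ring

expect-layerAverage : ∀ k α ψ → expect {k} α (λ A → layerAverage k ∣ A ∣ ψ) ≡ expect α ψ
expect-layerAverage k α ψ = begin
  sumSub k (λ A → biased α A * layerAverage k ∣ A ∣ ψ)
    ≡⟨ ext (λ A → cong (_* layerAverage k ∣ A ∣ ψ) (biased≡sizeWeight α A)) ⟩
  sumSub k (λ A → sizeWeight k α ∣ A ∣ * layerAverage k ∣ A ∣ ψ)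
    ≡⟨ sumSub-layerAverage k (sizeWeight k α) ψ ⟩
  sumSub k (λ A → sizeWeight k α ∣ A ∣ * ψ A)
    ≡⟨ ext (λ A → cong (_* ψ A) (biased≡sizeWeight α A)) ⟨
  sumSub k (λ A → biased α A * ψ A) ∎
  where open Summation (sumSub-summation k)

-- The correlated step on the grid

coordKernel : ∀ m → Bool → Fin (suc m) → Fin (suc m) → ℚ
coordKernel m a u v = if a then eqℚ u v else inv (suc m)

coordKernel-nonneg : ∀ m a u v → 0ℚ ≤ coordKernel m a u v
coordKernel-nonneg m true  u v = boolℚ-nonneg (isYes (u Data.Fin.≟ v))
coordKernel-nonneg m false u v = inv-nonneg (suc m)

coordKernel-sym : ∀ m a u v → coordKernel m a u v ≡ coordKernel m a v u
coordKernel-sym m true  u v = eqℚ-sym u v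
coordKernel-sym m false u v = refl

coordKernel-rowSum : ∀ m a u → sumFin (suc m) (coordKernel m a u) ≡ 1ℚ
coordKernel-rowSum m true  u = trans (ext (λ v → sym (ℚₚ.*-identityʳ (eqℚ u v))))
                                     (sumFin-eqℚ (suc m) u (λ _ → 1ℚ))
  where open Summation (sumFin-summation (suc m))
coordKernel-rowSum m false u = sumFin-inv m

coordKernel-compose : ∀ m a b u w →
  sumFin (suc m) (λ v → coordKernel m a u v * coordKernel m b v w) ≡ coordKernel m (a ∧ b) u w
coordKernel-compose m true  true  u w = sumFin-eqℚ (suc m) u (λ v → eqℚ v w)
coordKernel-compose m true  false u w = sumFin-eqℚ (suc m) u (λ _ → inv (suc m))
coordKernel-compose m false true  u w = begin
  sumFin (suc m) (λ v → inv (suc m) * eqℚ v w)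
    ≡⟨ ext (λ v → trans (ℚₚ.*-comm (inv (suc m)) (eqℚ v w)) (cong (_* inv (suc m)) (eqℚ-sym v w))) ⟩
  sumFin (suc m) (λ v → eqℚ w v * inv (suc m))
    ≡⟨ sumFin-eqℚ (suc m) w (λ _ → inv (suc m)) ⟩
  inv (suc m) ∎
  where open Summation (sumFin-summation (suc m))
coordKernel-compose m false false u w = begin
  sumFin (suc m) (λ _ → inv (suc m) * inv (suc m))  ≡⟨ sumFin-const (suc m) _ ⟩
  fromℕ (suc m) * (inv (suc m) * inv (suc m))       ≡⟨ ℚₚ.*-assoc (fromℕ (suc m)) _ _ ⟨
  fromℕ (suc m) * inv (suc m) * inv (suc m)         ≡⟨ cong (_* inv (suc m)) (fromℕ*inv m) ⟩
  1ℚ * inv (suc m)                                  ≡⟨ ℚₚ.*-identityˡ _ ⟩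
  inv (suc m)                                       ∎

module Grid {k : ℕ} (N : Fin k → ℕ) where

  Σₚ : (Point k N → ℚ) → ℚ
  Σₚ = sumΠ k (λ i → suc (N i))

  Σₚ-summation : Summation Σₚ
  Σₚ-summation = sumΠ-summation k _

  uniform : ℚ
  uniform = prodFin k (λ i → inv (suc (N i)))

  mean : (Point k N → ℚ) → ℚ
  mean f = Σₚ (λ x → uniform * f x)

  mean-summation : Summation mean
  mean-summation = weighted Σₚ-summation (λ _ → uniform)
                            (λ _ → prodFin-nonneg k (λ i → inv-nonneg (suc (N i))))

  mean-const : ∀ c → mean (λ _ → c) ≡ c
  mean-const c = begin
    Σₚ (λ _ → uniform * c)
      ≡⟨ homogeneousʳ c (λ _ → uniform) ⟩
    Σₚ (λ _ → uniform) * c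
      ≡⟨ cong (_* c) (sumΠ-prodFin k _ (λ i _ → inv (suc (N i)))) ⟩
    prodFin k (λ i → sumFin (suc (N i)) (λ _ → inv (suc (N i)))) * c
      ≡⟨ cong (_* c) (trans (prodFin-cong k (λ i → sumFin-inv (N i))) (prodFin-1 k)) ⟩
    1ℚ * c
      ≡⟨ ℚₚ.*-identityˡ c ⟩
    c ∎
    where open Summation Σₚ-summation

  kernel : Subset k → Point k N → Point k N → ℚ
  kernel A x y = prodFin k (λ i → coordKernel (N i) (A i) (x i) (y i))

  kernel-nonneg : ∀ A x y → 0ℚ ≤ kernel A x y
  kernel-nonneg A x y = prodFin-nonneg k (λ i → coordKernel-nonneg (N i) (A i) (x i) (y i))

  kernel-sym : ∀ A x y → kernel A x y ≡ kernel A y x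
  kernel-sym A x y = prodFin-cong k (λ i → coordKernel-sym (N i) (A i) (x i) (y i))

  kernel-cong : ∀ {A B} → (∀ i → A i ≡ B i) → ∀ x y → kernel A x y ≡ kernel B x y
  kernel-cong A≗B x y = prodFin-cong k (λ i → cong (λ a → coordKernel (N i) a (x i) (y i)) (A≗B i))

  kernel-rowSum : ∀ A x → Σₚ (kernel A x) ≡ 1ℚ
  kernel-rowSum A x = begin
    Σₚ (kernel A x)
      ≡⟨ sumΠ-prodFin k _ (λ i → coordKernel (N i) (A i) (x i)) ⟩
    prodFin k (λ i → sumFin (suc (N i)) (coordKernel (N i) (A i) (x i)))
      ≡⟨ prodFin-cong k (λ i → coordKernel-rowSum (N i) (A i) (x i)) ⟩
    prodFin k (λ _ → 1ℚ)
      ≡⟨ prodFin-1 k ⟩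
    1ℚ ∎

  kernel-compose : ∀ A B x z → Σₚ (λ y → kernel A x y * kernel B y z) ≡ kernel (A ∩ B) x z
  kernel-compose A B x z = begin
    Σₚ (λ y → kernel A x y * kernel B y z)
      ≡⟨ ext (λ y → prodFin-* k _ _) ⟨
    Σₚ (λ y → prodFin k (λ i → κ i (A i) (x i) (y i) * κ i (B i) (y i) (z i)))
      ≡⟨ sumΠ-prodFin k _ (λ i v → κ i (A i) (x i) v * κ i (B i) v (z i)) ⟩
    prodFin k (λ i → sumFin (suc (N i)) (λ v → κ i (A i) (x i) v * κ i (B i) v (z i)))
      ≡⟨ prodFin-cong k (λ i → coordKernel-compose (N i) (A i) (B i) (x i) (z i)) ⟩
    kernel (A ∩ B) x z ∎
    where
    open Summation Σₚ-summation
    κ : (i : Fin k) → Bool → Fin (suc (N i)) → Fin (suc (N i)) → ℚ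
    κ i = coordKernel (N i)

  step : Subset k → (Point k N → ℚ) → Point k N → ℚ
  step A f x = Σₚ (λ y → kernel A x y * f y)

  step-summation : ∀ A x → Summation (λ f → step A f x)
  step-summation A x = weighted Σₚ-summation (kernel A x) (kernel-nonneg A x)

  step-const : ∀ A c x → step A (λ _ → c) x ≡ c
  step-const A c x = begin
    Σₚ (λ y → kernel A x y * c) ≡⟨ homogeneousʳ c (kernel A x) ⟩
    Σₚ (kernel A x) * c         ≡⟨ cong (_* c) (kernel-rowSum A x) ⟩
    1ℚ * c                      ≡⟨ ℚₚ.*-identityˡ c ⟩
    c                           ∎
    where open Summation Σₚ-summation

  step-∩ : ∀ A B f x → step (A ∩ B) f x ≡ step A (step B f) x
  step-∩ A B f x = begin
    Σₚ (λ z → kernel (A ∩ B) x z * f z)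
      ≡⟨ ext (λ z → cong (_* f z) (kernel-compose A B x z)) ⟨
    Σₚ (λ z → Σₚ (λ y → kernel A x y * kernel B y z) * f z)
      ≡⟨ ext regroup ⟨
    Σₚ (λ z → Σₚ (λ y → kernel A x y * (kernel B y z * f z)))
      ≡⟨ interchange linear (λ z y → kernel A x y * (kernel B y z * f z)) ⟩
    Σₚ (λ y → Σₚ (λ z → kernel A x y * (kernel B y z * f z)))
      ≡⟨ ext (λ y → homogeneous (kernel A x y) _) ⟩
    Σₚ (λ y → kernel A x y * step B f y) ∎
    where
    open Summation Σₚ-summation
    regroup : ∀ z → Σₚ (λ y → kernel A x y * (kernel B y z * f z)) ≡ Σₚ (λ y → kernel A x y * kernel B y z) * f z
    regroup z = trans (ext (λ y → sym (ℚₚ.*-assoc (kernel A x y) (kernel B y z) (f z))))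
                      (homogeneousʳ (f z) (λ y → kernel A x y * kernel B y z))

  -- The uniform law is stationary because the kernel is symmetric.
  mean-step : ∀ A f → mean (step A f) ≡ mean f
  mean-step A f = begin
    Σₚ (λ x → uniform * Σₚ (λ y → kernel A x y * f y))
      ≡⟨ ext (λ x → homogeneous uniform _) ⟨
    Σₚ (λ x → Σₚ (λ y → uniform * (kernel A x y * f y)))
      ≡⟨ interchange linear (λ x y → uniform * (kernel A x y * f y)) ⟩
    Σₚ (λ y → Σₚ (λ x → uniform * (kernel A x y * f y)))
      ≡⟨ ext (λ y → ext (λ x → transpose x y)) ⟩
    Σₚ (λ y → Σₚ (λ x → kernel A y x * (uniform * f y)))
      ≡⟨ ext (λ y → trans (homogeneousʳ _ (kernel A y)) (cong (_* (uniform * f y)) (kernel-rowSum A y))) ⟩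
    Σₚ (λ y → 1ℚ * (uniform * f y))
      ≡⟨ ext (λ y → ℚₚ.*-identityˡ _) ⟩
    mean f ∎
    where
    open Summation Σₚ-summation
    u[ac]≡a[uc] : ∀ u a c → u * (a * c) ≡ a * (u * c)
    u[ac]≡a[uc] = solve-∀ ℚ-ring
    transpose : ∀ x y → uniform * (kernel A x y * f y) ≡ kernel A y x * (uniform * f y)
    transpose x y = trans (u[ac]≡a[uc] uniform (kernel A x y) (f y))
                          (cong (_* (uniform * f y)) (kernel-sym A x y))

  sumΠ²-sumSub : ∀ (w : Subset k → ℚ) (φ : Subset k → Point k N → Point k N → ℚ) →
    Σₚ (λ x → Σₚ (λ y → sumSub k (λ A → w A * (uniform * (kernel A x y * φ A x y))))) ≡
    sumSub k (λ A → w A * mean (λ x → step A (φ A x) x))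
  sumΠ²-sumSub w φ = begin
    Σₚ (λ x → Σₚ (λ y → sumSub k (λ A → F A x y)))
      ≡⟨ Points.ext (λ x → Sub.interchange Points.linear (λ A y → F A x y)) ⟨
    Σₚ (λ x → sumSub k (λ A → Σₚ (F A x)))
      ≡⟨ Sub.interchange Points.linear (λ A x → Σₚ (F A x)) ⟨
    sumSub k (λ A → Σₚ (λ x → Σₚ (F A x)))
      ≡⟨ Sub.ext (λ A → Points.ext (λ x → pull-out A x)) ⟩
    sumSub k (λ A → Σₚ (λ x → w A * (uniform * step A (φ A x) x)))
      ≡⟨ Sub.ext (λ A → Points.homogeneous (w A) _) ⟩
    sumSub k (λ A → w A * mean (λ x → step A (φ A x) x)) ∎
    where
    module Points = Summation Σₚ-summation
    module Sub = Summation (sumSub-summation k)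
    F : Subset k → Point k N → Point k N → ℚ
    F A x y = w A * (uniform * (kernel A x y * φ A x y))
    pull-out : ∀ A x → Σₚ (F A x) ≡ w A * (uniform * step A (φ A x) x)
    pull-out A x = trans (Points.homogeneous (w A) _) (cong (w A *_) (Points.homogeneous uniform _))

-- The tests

T-andFin⁻ : ∀ n {p} → T (andFin n p) → ∀ i → T (p i)
T-andFin⁻ (suc n) {p} t = pick
  where
  both : T (p zero) × T (andFin n (p ∘ suc))
  both = Equivalence.to T-∧ (subst T (andFin-suc n p) t)
  pick : ∀ i → T (p i)
  pick zero    = proj₁ both
  pick (suc i) = T-andFin⁻ n (proj₂ both) i

T-andFin⁺ : ∀ n {p} → (∀ i → T (p i)) → T (andFin n p)
T-andFin⁺ zero    _  = tt
T-andFin⁺ (suc n) {p} Tp =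
  subst T (sym (andFin-suc n p)) (Equivalence.from T-∧ (Tp zero , T-andFin⁺ n (Tp ∘ suc)))

agree-trans : ∀ a b {m} {u v w : Fin m} → T (not a ∨ isYes (u Data.Fin.≟ v)) →
              T (not b ∨ isYes (v Data.Fin.≟ w)) → T (not (a ∧ b) ∨ isYes (u Data.Fin.≟ w))
agree-trans false b     _   _   = tt
agree-trans true  false _   _   = tt
agree-trans true  true  u≈v v≈w = fromWitness (trans (toWitness u≈v) (toWitness v≈w))

boolℚ-not-triangle : ∀ a b c → (T a → T b → T c) →
                     boolℚ (not c) ≤ boolℚ (not a) + boolℚ (not b)
boolℚ-not-triangle a     b     true  _   = ℚₚ.+-mono-≤ (boolℚ-nonneg (not a)) (boolℚ-nonneg (not b))
boolℚ-not-triangle false b     false _   = ℚₚ.+-monoʳ-≤ 1ℚ (boolℚ-nonneg (not b))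
boolℚ-not-triangle true  false false _   = ℚₚ.≤-refl
boolℚ-not-triangle true  true  false a→b→c = ⊥-elim (a→b→c tt tt)

module Test {k M : ℕ} {N : Fin k → ℕ} (g : Map k M N) where

  open Grid N

  accepts-trans : ∀ {x y z A B} → T (accepts g x y A) → T (accepts g y z B) → T (accepts g x z (A ∩ B))
  accepts-trans {A = A} {B} xy yz =
    T-andFin⁺ k (λ i → agree-trans (A i) (B i) (T-andFin⁻ k xy i) (T-andFin⁻ k yz i))

  accepts-cong : ∀ {A B} → (∀ i → A i ≡ B i) → ∀ x y → accepts g x y A ≡ accepts g x y B
  accepts-cong A≗B x y =
    andFin-cong k (λ i → cong (λ a → not a ∨ isYes (g x i Data.Fin.≟ g y i)) (A≗B i))

  accept reject : Subset k → Point k N → Point k N → ℚ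
  accept A x y = boolℚ (accepts g x y A)
  reject A x y = boolℚ (not (accepts g x y A))

  reject-triangle : ∀ A B x y z → reject (A ∩ B) x z ≤ reject A x y + reject B y z
  reject-triangle A B x y z = boolℚ-not-triangle _ _ _ accepts-trans

  acceptProb rejectProb : Subset k → ℚ
  acceptProb A = mean (λ x → step A (accept A x) x)
  rejectProb A = mean (λ x → step A (reject A x) x)

  acceptProb≡1-rejectProb : ∀ A → acceptProb A ≡ 1ℚ - rejectProb A
  acceptProb≡1-rejectProb A = trans (a≡a+r-r (acceptProb A) (rejectProb A)) (cong (_- rejectProb A) total)
    where
    module Mean = Summation mean-summation
    module Step x = Summation (step-summation A x)
    a≡a+r-r : ∀ a r → a ≡ a + r - r
    a≡a+r-r = solve-∀ ℚ-ring
    total : acceptProb A + rejectProb A ≡ 1ℚ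
    total = begin
      acceptProb A + rejectProb A
        ≡⟨ Mean.additive _ _ ⟨
      mean (λ x → step A (accept A x) x + step A (reject A x) x)
        ≡⟨ Mean.ext (λ x → Step.additive x _ _) ⟨
      mean (λ x → step A (λ y → accept A x y + reject A x y) x)
        ≡⟨ Mean.ext (λ x → trans (Step.ext x (λ y → boolℚ+boolℚ-not (accepts g x y A)))
                                 (step-const A 1ℚ x)) ⟩
      mean (λ _ → 1ℚ)
        ≡⟨ mean-const 1ℚ ⟩
      1ℚ ∎

  rejectProb-nonneg : ∀ A → 0ℚ ≤ rejectProb A
  rejectProb-nonneg A = Summation.nonneg mean-summation
    (λ x → Summation.nonneg (step-summation A x) (λ y → boolℚ-nonneg (not (accepts g x y A))))

  rejectProb-ext : Extensional rejectProb
  rejectProb-ext A≗B = Summation.ext mean-summation (λ x → Summation.ext Σₚ-summation (λ y →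
    cong₂ _*_ (kernel-cong A≗B x y) (cong (boolℚ ∘ not) (accepts-cong A≗B x y))))

  rejectProb-∩ : ∀ A B → rejectProb (A ∩ B) ≤ rejectProb A + rejectProb B
  rejectProb-∩ A B = subst₂ _≤_ (sym chapmanKolmogorov) split
    (Mean.monotone (λ x → Step.monotone A x (λ y → through x y)))
    where
    module Mean = Summation mean-summation
    module Step A x = Summation (step-summation A x)
    chapmanKolmogorov : rejectProb (A ∩ B) ≡ mean (λ x → step A (step B (reject (A ∩ B) x)) x)
    chapmanKolmogorov = Mean.ext (λ x → step-∩ A B (reject (A ∩ B) x) x)
    through : ∀ x y → step B (reject (A ∩ B) x) y ≤ reject A x y + step B (reject B y) y
    through x y = subst (step B (reject (A ∩ B) x) y ≤_)
      (trans (Step.additive B y (λ _ → reject A x y) (reject B y))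
             (cong (_+ step B (reject B y) y) (step-const B _ y)))
      (Step.monotone B y (reject-triangle A B x y))
    split : mean (λ x → step A (λ y → reject A x y + step B (reject B y) y) x) ≡ rejectProb A + rejectProb B
    split = begin
      mean (λ x → step A (λ y → reject A x y + step B (reject B y) y) x)
        ≡⟨ Mean.ext (λ x → Step.additive A x (reject A x) (λ y → step B (reject B y) y)) ⟩
      mean (λ x → step A (reject A x) x + step A (λ y → step B (reject B y) y) x)
        ≡⟨ Mean.additive _ _ ⟩
      rejectProb A + mean (step A (λ y → step B (reject B y) y))
        ≡⟨ cong (_+_ (rejectProb A)) (mean-step A (λ y → step B (reject B y) y)) ⟩
      rejectProb A + rejectProb B ∎

  private
    module Points = Summation Σₚ-summation
    module Sub = Summation (sumSub-summation k)

  passT≡expect-acceptProb : ∀ α → passT α g ≡ expect α acceptProb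
  passT≡expect-acceptProb α = begin
    passT α g
      ≡⟨ Points.ext (λ x → Points.ext (λ y → sumSubsets≡sumSub k (summand-ext x y))) ⟩
    Σₚ (λ x → Σₚ (λ y → sumSub k (summand x y)))
      ≡⟨ Points.ext (λ x → Points.ext (λ y → Sub.ext (factor x y))) ⟩
    Σₚ (λ x → Σₚ (λ y → sumSub k (λ A → biased α A * (uniform * (kernel A x y * accept A x y)))))
      ≡⟨ sumΠ²-sumSub (biased α) accept ⟩
    expect α acceptProb ∎
    where
    coordinate : Bool → ∀ {m} → Fin (suc m) → Fin (suc m) → ℚ
    coordinate a {m} u v = if a then α * eqℚ u v else (1ℚ - α) * inv (suc m)
    summand : Point k N → Point k N → Subset k → ℚ
    summand x y A = uniform * prodFin k (λ i → coordinate (A i) (x i) (y i)) * accept A x y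
    summand-ext : ∀ x y → Extensional (summand x y)
    summand-ext x y A≗B = cong₂ (λ P a → uniform * P * a)
      (prodFin-cong k (λ i → cong (λ a → coordinate a (x i) (y i)) (A≗B i)))
      (cong boolℚ (accepts-cong A≗B x y))
    u[μκ]a≡μ[u[κa]] : ∀ u μ κ a → u * (μ * κ) * a ≡ μ * (u * (κ * a))
    u[μκ]a≡μ[u[κa]] = solve-∀ ℚ-ring
    factor : ∀ x y A → summand x y A ≡ biased α A * (uniform * (kernel A x y * accept A x y))
    factor x y A = trans
      (cong (λ P → uniform * P * accept A x y)
            (trans (prodFin-cong k (λ i → bernoulli-split α (A i) _ _)) (prodFin-* k _ _)))
      (u[μκ]a≡μ[u[κa]] uniform (biased α A) (kernel A x y) (accept A x y))

  passTfix≡layerAverage : ∀ t → passTfix t g ≡ layerAverage k t acceptProb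
  passTfix≡layerAverage t = begin
    passTfix t g
      ≡⟨ Points.ext (λ x → Points.ext (λ y → sumSubsets≡sumSub k (summand-ext x y))) ⟩
    Σₚ (λ x → Σₚ (λ y → sumSub k (summand x y)))
      ≡⟨ Points.ext (λ x → Points.ext (λ y → Sub.ext (λ T →
           regroup uniform (δ ∣ T ∣ t) (inv (k C t)) (kernel T x y) (accept T x y)))) ⟩
    Σₚ (λ x → Σₚ (λ y → sumSub k (λ T → w T * (uniform * (kernel T x y * accept T x y)))))
      ≡⟨ sumΠ²-sumSub w accept ⟩
    sumSub k (λ T → w T * acceptProb T)
      ≡⟨ Sub.ext (λ T → ℚₚ.*-assoc (inv (k C t)) (δ ∣ T ∣ t) (acceptProb T)) ⟩
    sumSub k (λ T → inv (k C t) * (δ ∣ T ∣ t * acceptProb T))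
      ≡⟨ Sub.homogeneous (inv (k C t)) _ ⟩
    layerAverage k t acceptProb ∎
    where
    w : Subset k → ℚ
    w T = inv (k C t) * δ ∣ T ∣ t
    summand : Point k N → Point k N → Subset k → ℚ
    summand x y T = uniform * δ ∣ T ∣ t * inv (k C t) * kernel T x y * accept T x y
    summand-ext : ∀ x y → Extensional (summand x y)
    summand-ext x y T≗T′ = cong₃ (λ n κ a → uniform * δ n t * inv (k C t) * κ * a)
      (countFin-cong k T≗T′) (kernel-cong T≗T′ x y) (cong boolℚ (accepts-cong T≗T′ x y))
      where
      cong₃ : ∀ {A B C D : Set} (f : A → B → C → D) {a a′ b b′ c c′} →
              a ≡ a′ → b ≡ b′ → c ≡ c′ → f a b c ≡ f a′ b′ c′
      cong₃ f refl refl refl = refl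
    regroup : ∀ u d c κ a → u * d * c * κ * a ≡ (c * d) * (u * (κ * a))
    regroup = solve-∀ ℚ-ring

  passT≡expect-passTfix : ∀ α → passT α g ≡ expect {k} α (λ A → passTfix ∣ A ∣ g)
  passT≡expect-passTfix α = begin
    passT α g
      ≡⟨ passT≡expect-acceptProb α ⟩
    expect α acceptProb
      ≡⟨ expect-layerAverage k α acceptProb ⟨
    expect {k} α (λ A → layerAverage k ∣ A ∣ acceptProb)
      ≡⟨ Linear.ext (expect-linear k α) (λ A → passTfix≡layerAverage ∣ A ∣) ⟨
    expect {k} α (λ A → passTfix ∣ A ∣ g) ∎

  passTfix≤1 : ∀ {t} → t ℕ.≤ k → passTfix t g ≤ 1ℚ
  passTfix≤1 {t} t≤k = subst₂ _≤_ (sym (passTfix≡layerAverage t)) layer-mass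
    (*-monoˡ-≤-nonneg (inv-nonneg (k C t))
      (Sub.monotone (λ T → *-monoˡ-≤-nonneg (δ-nonneg ∣ T ∣ t) (acceptProb≤1 T))))
    where
    acceptProb≤1 : ∀ A → acceptProb A ≤ 1ℚ
    acceptProb≤1 A = subst (_≤ 1ℚ) (sym (acceptProb≡1-rejectProb A))
      (subst (1ℚ - rejectProb A ≤_) (ℚₚ.+-identityʳ 1ℚ) (sub-antimonoʳ-≤ 1ℚ (rejectProb-nonneg A)))
    layer-mass : inv (k C t) * sumSub k (λ T → δ ∣ T ∣ t * 1ℚ) ≡ 1ℚ
    layer-mass = begin
      inv (k C t) * sumSub k (λ T → δ ∣ T ∣ t * 1ℚ)
        ≡⟨ cong (inv (k C t) *_) (trans (Sub.ext (λ T → ℚₚ.*-identityʳ _)) (layerSize k t)) ⟩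
      inv (k C t) * fromℕ (k C t)
        ≡⟨ ℚₚ.*-comm (inv (k C t)) _ ⟩
      fromℕ (k C t) * inv (k C t)
        ≡⟨ fromℕ*inv-positive (C-positive t≤k) ⟩
      1ℚ ∎

  passT≡1-expect-rejectProb : ∀ α → passT α g ≡ 1ℚ - expect α rejectProb
  passT≡1-expect-rejectProb α = begin
    passT α g                        ≡⟨ passT≡expect-acceptProb α ⟩
    expect α acceptProb              ≡⟨ Linear.ext (expect-linear k α) acceptProb≡1-rejectProb ⟩
    expect α (λ A → 1ℚ - rejectProb A) ≡⟨ expect-complement k α rejectProb ⟩
    1ℚ - expect α rejectProb         ∎

module _ {k M : ℕ} {N : Fin k → ℕ} (g : Map k M N) {α ε : ℚ} (0≤α : 0ℚ ≤ α) (α≤1 : α ≤ 1ℚ)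
         (pass : 1ℚ - ε ≤ passT α g) where

  open Test g
  private
    module E = Summation (expect-summation k 0≤α α≤1)

  expect-rejectProb≤ε : expect α rejectProb ≤ ε
  expect-rejectProb≤ε = sub-cancelʳ-≤ 1ℚ (subst (1ℚ - ε ≤_) (passT≡1-expect-rejectProb α) pass)

  passT-α² : 1ℚ - (+ 2 / 1) * ε ≤ passT (α * α) g
  passT-α² = subst (1ℚ - (+ 2 / 1) * ε ≤_) (sym (passT≡1-expect-rejectProb (α * α)))
                   (sub-antimonoʳ-≤ 1ℚ R²≤2ε)
    where
    R : ℚ
    R = expect α rejectProb
    x+x≡2x : ∀ x → x + x ≡ + 2 / 1 * x
    x+x≡2x = solve-∀ ℚ-ring
    sum-twice : expect α (λ A → expect α (λ B → rejectProb A + rejectProb B)) ≡ R + R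
    sum-twice = begin
      expect α (λ A → expect α (λ B → rejectProb A + rejectProb B))
        ≡⟨ E.ext (λ A → trans (E.additive (λ _ → rejectProb A) rejectProb)
                              (cong (_+ R) (expect-const k α (rejectProb A)))) ⟩
      expect α (λ A → rejectProb A + R)
        ≡⟨ E.additive rejectProb (λ _ → R) ⟩
      R + expect {k} α (λ _ → R)
        ≡⟨ cong (_+_ R) (expect-const k α R) ⟩
      R + R ∎
    R²≤2ε : expect (α * α) rejectProb ≤ (+ 2 / 1) * ε
    R²≤2ε = subst₂ _≤_ (sym (expect-∩ α rejectProb rejectProb-ext)) (x+x≡2x ε)
      (ℚₚ.≤-trans (E.monotone (λ A → E.monotone (λ B → rejectProb-∩ A B)))
                  (subst (_≤ ε + ε) (sym sum-twice) (ℚₚ.+-mono-≤ expect-rejectProb≤ε expect-rejectProb≤ε)))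

  ∃-near-passTfix : 1 ℕ.≤ k → 0ℚ < ε →
                    Σ ℕ λ t → (t ℕ.≤ k) × Near k α t × (1ℚ - (+ 2 / 1) * ε ≤ passTfix t g)
  ∃-near-passTfix 1≤k 0<ε
    with ℕₚ.anyUpTo? (λ t → near? k α t ×-dec ((1ℚ - (+ 2 / 1) * ε) ℚₚ.≤? passTfix t g)) (suc k)
  ... | yes (t , t<1+k , near , fine) = t , ℕ.s≤s⁻¹ t<1+k , near , fine
  ... | no none = ⊥-elim (ℚₚ.<-irrefl refl (ℚₚ.<-≤-trans ε<2ε·¾ 2ε·¾≤ε))
    where
    r : Subset k → ℚ
    r A = 1ℚ - passTfix ∣ A ∣ g
    1-[1-x]≡x : ∀ x → 1ℚ - (1ℚ - x) ≡ x
    1-[1-x]≡x = solve-∀ ℚ-ring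
    2ε≤r : ∀ A → Near k α ∣ A ∣ → (+ 2 / 1) * ε ≤ r A
    2ε≤r A near = subst (_≤ r A) (1-[1-x]≡x _) (sub-antimonoʳ-≤ 1ℚ (ℚₚ.<⇒≤ (ℚₚ.≰⇒> unfit)))
      where
      unfit : ¬ (1ℚ - (+ 2 / 1) * ε ≤ passTfix ∣ A ∣ g)
      unfit fine = none (∣ A ∣ , ℕ.s≤s (∣∣≤ A) , near , fine)
    expect-r≤ε : expect α r ≤ ε
    expect-r≤ε = subst (_≤ ε)
      (sym (trans (expect-complement k α (λ A → passTfix ∣ A ∣ g))
                  (cong (_-_ 1ℚ) (sym (passT≡expect-passTfix α)))))
      (complement-≤ pass)
    0≤2ε : 0ℚ ≤ (+ 2 / 1) * ε
    0≤2ε = *-nonneg (ℚₚ.nonNegative⁻¹ (+ 2 / 1)) (ℚₚ.<⇒≤ 0<ε)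
    2ε·¾≤ε : (+ 2 / 1) * ε * (+ 3 / 4) ≤ ε
    2ε·¾≤ε = ℚₚ.≤-trans (*-monoˡ-≤-nonneg 0≤2ε (chebyshev k 1≤k 0≤α α≤1))
      (ℚₚ.≤-trans (markov (expect-summation k 0≤α α≤1) (near? k α ∘ ∣_∣)
                          (λ A → ≤⇒0≤- (passTfix≤1 (∣∣≤ A))) 2ε≤r)
                  expect-r≤ε)
    2x·¾≡x+x·½ : ∀ x → (+ 2 / 1) * x * (+ 3 / 4) ≡ x + x * (+ 1 / 2)
    2x·¾≡x+x·½ = solve-∀ ℚ-ring
    ε<2ε·¾ : ε < (+ 2 / 1) * ε * (+ 3 / 4)
    ε<2ε·¾ = subst₂ _<_ (ℚₚ.+-identityʳ ε) (sym (2x·¾≡x+x·½ ε))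
      (ℚₚ.+-monoʳ-< ε (ℚₚ.positive⁻¹ _ {{ℚₚ.pos*pos⇒pos ε {{positive 0<ε}} (+ 1 / 2)}}))

lemma4p3 : Σ ℚ λ C → (0ℚ < C) ×
    ((k M : ℕ) (N : Fin k → ℕ) → 1 Data.Nat.≤ k → 1 Data.Nat.≤ M →
    ((i : Fin k) → 1 Data.Nat.≤ N i) →
    (α ε : ℚ) → 0ℚ ≤ α → α ≤ 1ℚ → 0ℚ < ε →
    (g : Map k M N) →
    1ℚ - ε ≤ passT α g →
    (1ℚ - ((+ 2) / 1) * ε ≤ passT (α * α) g)
    × (Σ ℕ λ t → (t Data.Nat.≤ k)
    × (((+ t) / 1 - α * ((+ k) / 1)) * ((+ t) / 1 - α * ((+ k) / 1)) ≤ (+ k) / 1)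
    × (1ℚ - C * ε ≤ passTfix t g)))
lemma4p3 = + 2 / 1 , ℚₚ.positive⁻¹ (+ 2 / 1) ,
  λ k M N 1≤k _ _ α ε 0≤α α≤1 0<ε g pass →
    passT-α² g {α} {ε} 0≤α α≤1 pass , ∃-near-passTfix g {α} {ε} 0≤α α≤1 pass 1≤k 0<ε
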